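{- Let $\mathbf{c}=(c_0,c_1,\ldots)$ be a sequence of numbers such that the unique sequence $P_n(y)$, $n\ge 0$, of monic polynomials orthogonal with respect to $\mathbf{c}$ exists, and let $(s_n)_{n\ge 0}$, $(t_n)_{n\ge 1}$ be the coefficient sequences in the three-term recurrence $P_0(y)=1$, $P_1(y)=y+s_0$, $P_{n+1}(y)=(y+s_n)P_n(y)-t_nP_{n-1}(y)$ $(n\ge 1)$. Let $\alpha$ be a constant and define $\mathbf{b}=(b_0,b_1,\ldots)$ by $b_0:=\alpha$ and $b_k:=c_{k-1}$ for $k\ge 1$. Then for all $n\ge 2$, $$\frac{H_{n+1}(b_k)}{H_n(c_k)} = -s_n\frac{H_n(b_k)}{H_{n-1}(c_k)}-t_n\frac{H_{n-1}(b_k)}{H_{n-2}(c_k)}.$$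
   Context: For a sequence $(a_k)_{k\ge 0}$ and $n\ge 0$, $H_n(a_k):=\det(a_{i+j})_{0\le i,j\le n}$ denotes the $(n+1)\times(n+1)$ Hankel determinant. Given $\mathbf{c}=(c_0,c_1,\ldots)$, let $L$ be the linear functional on polynomials with $L(y^k)=c_k$ for all $k\ge0$. The monic orthogonal polynomials with respect to $\mathbf{c}$ are the monic polynomials $P_n(y)$ of degree $n$ with $L(P_mP_n)=\zeta_n\delta_{m,n}$ and $\zeta_n\ne 0$; they exist (uniquely) if and only if $H_n(c_k)\neq0$ for all $n\ge0$, and they satisfy a three-term recurrence of the form stated in the claim. -}

module Defs where

open import Algebra.Apartness.Bundles using (HeytingField)
open import Level using (_⊔_)
open import Data.Nat.Base as ℕ using (ℕ; zero; suc)
open import Data.Fin.Base using (Fin; zero; suc; toℕ; punchIn)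
open import Data.List.Base using (List; []; _∷_; length; lookup; map)
open import Data.Product.Base using (_×_; proj₁)
open import Algebra.Bundles using (Semiring)
import Algebra.Definitions.RawSemiring as RawSemiringDefinitions
open import Relation.Binary.PropositionalEquality.Core using (_≢_)

-- The numbers form an arbitrary field, with "≠" read as the tight apartness _#_.
-- A field with decidable equality is the case where _#_ is the negation of _≈_.
module Hankel {a ℓ₁ ℓ₂} (F : HeytingField a ℓ₁ ℓ₂) where

  open HeytingField F
    using (Carrier; _≈_; _#_; _+_; _*_; -_; 0#; 1#; #⇒invertible; isSemiring)

  private
    semiring : Semiring a ℓ₁
    semiring = record { isSemiring = isSemiring }

  open RawSemiringDefinitions (Semiring.rawSemiring semiring)
    using (_^_; sum)

  infixl 7 _/_[_]
  infixl 7 _·_ _∙_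
  infixl 6 _⊕_ _⊖_
  infix  4 _≋_

  -- The library inverts y - 0#, which equals y.
  _/_[_] : Carrier → (y : Carrier) → y # 0# → Carrier
  x / y [ y#0 ] = x * proj₁ (#⇒invertible y#0)

  Sequence : Set a
  Sequence = ℕ → Carrier

  -- α, c₀, c₁, c₂, …
  prepend : Carrier → Sequence → Sequence
  prepend α c zero    = α
  prepend α c (suc k) = c k

  Matrix : ℕ → Set a
  Matrix n = Fin n → Fin n → Carrier

  -- Laplace expansion along the first row.
  det : ∀ {n} → Matrix n → Carrier
  det {zero}  M = 1#
  det {suc n} M =
    sum λ j → (- 1#) ^ toℕ j * M zero j * det λ i k → M (suc i) (punchIn j k)

  -- The index is one less than the size of the matrix.
  H : ℕ → Sequence → Carrier
  H n x = det {suc n} λ i j → x (toℕ i ℕ.+ toℕ j)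

  -- Coefficients, lowest degree first; trailing zeros are allowed, and _≋_ does
  -- not see them.
  Poly : Set a
  Poly = List Carrier

  coeff : Poly → ℕ → Carrier
  coeff []      k       = 0#
  coeff (x ∷ p) zero    = x
  coeff (x ∷ p) (suc k) = coeff p k

  _≋_ : Poly → Poly → Set ℓ₁
  p ≋ q = ∀ k → coeff p k ≈ coeff q k

  const : Carrier → Poly
  const x = x ∷ []

  Y : Poly
  Y = 0# ∷ 1# ∷ []

  _⊕_ : Poly → Poly → Poly
  []      ⊕ q       = q
  (x ∷ p) ⊕ []      = x ∷ p
  (x ∷ p) ⊕ (y ∷ q) = (x + y) ∷ (p ⊕ q)

  _∙_ : Carrier → Poly → Poly
  x ∙ p = map (x *_) p

  _⊖_ : Poly → Poly → Poly
  p ⊖ q = p ⊕ map -_ q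

  _·_ : Poly → Poly → Poly
  []      · q = []
  (x ∷ p) · q = x ∙ q ⊕ (0# ∷ p · q)

  MonicOfDegree : ℕ → Poly → Set ℓ₁
  MonicOfDegree n p = coeff p n ≈ 1# × (∀ k → n ℕ.< k → coeff p k ≈ 0#)

  -- The linear functional on polynomials sending the k-th power of Y to c k.
  L : Sequence → Poly → Carrier
  L c p = sum {length p} λ i → lookup p i * c (toℕ i)

  record MonicOrthogonal (c : Sequence) (P : ℕ → Poly) : Set (a ⊔ ℓ₁ ⊔ ℓ₂) where
    field
      monic      : ∀ n → MonicOfDegree n (P n)
      ζ          : Sequence
      ζ#0        : ∀ n → ζ n # 0#
      diagonal   : ∀ n → L c (P n · P n) ≈ ζ n
      orthogonal : ∀ m n → m ≢ n → L c (P m · P n) ≈ 0#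

  -- The value t 0 is not used.
  record ThreeTermRecurrence (P : ℕ → Poly) (s t : Sequence) : Set ℓ₁ where
    field
      P₀   : P 0 ≋ const 1#
      P₁   : P 1 ≋ Y ⊕ const (s 0)
      step : ∀ n → 1 ℕ.≤ n →
             P (suc n) ≋ (Y ⊕ const (s n)) · P n ⊖ t n ∙ P (n ℕ.∸ 1)

{-# OPTIONS --safe #-}
module Submission where

-- Replacing the last column of the Hankel matrix of a by the combination of its columns
-- with the coefficients of P n leaves the determinant unchanged (P n is monic) and turns
-- that column into L (shift i a) (P n), i ≤ n.  For a = c it is (0, …, 0, ζ n), so
-- H n c ≈ ζ n * H (n − 1) c; for a = b it is (L b (P n), 0, …, 0), so
-- H n b ≈ (−1)ⁿ * L b (P n) * H (n − 1) c.  As L b (Y · p) ≈ L c p and L c (P n) ≈ 0,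
-- applying L b to the three-term recurrence gives the recurrence of the ratios.

open import Defs
open import Algebra.Apartness.Bundles using (HeytingField; HeytingCommutativeRing)
open import Algebra.Bundles using (CommutativeRing)
open import Data.Nat.Base as ℕ using (ℕ; zero; suc)
open import Data.Product.Base using (Σ-syntax; _×_; _,_)
open import Data.Fin.Base as Fin using (Fin; zero; suc; toℕ; fromℕ; inject₁; punchIn; punchOut)
open import Data.Fin.Induction using (<-weakInduction)
open import Data.Fin.Properties
  using (_≟_; <-cmp; toℕ<n; inject₁ℕ<; suc-injective; toℕ-fromℕ; toℕ-inject₁; toℕ-injective;
         fromℕ≢inject₁; punchInᵢ≢i; punchIn-injective; punchIn-punchOut)
open import Data.List.Base using ([]; _∷_; map)
import Data.Nat.Properties as ℕ
open import Data.Vec.Functional using (Vector; updateAt)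
open import Data.Vec.Functional.Properties
  using (updateAt-updates; updateAt-minimal; updateAt-commutes)
open import Function.Base using (_∘_)
open import Relation.Binary.Definitions using (tri<; tri≈; tri>)
open import Relation.Binary.PropositionalEquality.Core as ≡ using (_≡_; _≢_)
open import Relation.Nullary.Decidable.Core using (yes; no)
open import Relation.Nullary.Negation.Core using (contradiction)

-- How deleting an index acts on adjacent, initial and last indices.

-- Two neighbours stay neighbours when another index is deleted, so a minor of a matrix with two
-- equal adjacent columns has such columns again.
punchIn-adjacent : ∀ {n} (j : Fin (suc (suc n))) (p : Fin (suc n)) →
  j ≢ inject₁ p → j ≢ suc p →
  Σ[ q ∈ Fin n ] punchIn j (inject₁ q) ≡ inject₁ p × punchIn j (suc q) ≡ suc p
punchIn-adjacent zero zero j≢p _ = contradiction ≡.refl j≢p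
punchIn-adjacent zero (suc p) _ _ = p , ≡.refl , ≡.refl
punchIn-adjacent (suc zero) zero _ j≢1+p = contradiction ≡.refl j≢1+p
punchIn-adjacent {suc n} (suc (suc j)) zero _ _ = zero , ≡.refl , ≡.refl
punchIn-adjacent {suc n} (suc j) (suc p) j≢p j≢1+p
  with q , eq , eq′ ← punchIn-adjacent j p (j≢p ∘ ≡.cong suc) (j≢1+p ∘ ≡.cong suc)
  = suc q , ≡.cong suc eq , ≡.cong suc eq′

punchIn-inject₁ : ∀ {n} (j : Fin (suc n)) (k : Fin n) →
  punchIn (inject₁ j) (inject₁ k) ≡ inject₁ (punchIn j k)
punchIn-inject₁ zero    k       = ≡.refl
punchIn-inject₁ (suc j) zero    = ≡.refl
punchIn-inject₁ (suc j) (suc k) = ≡.cong suc (punchIn-inject₁ j k)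

punchIn-inject₁-fromℕ : ∀ {n} (j : Fin (suc n)) →
  punchIn (inject₁ j) (fromℕ n) ≡ fromℕ (suc n)
punchIn-inject₁-fromℕ         zero    = ≡.refl
punchIn-inject₁-fromℕ {suc n} (suc j) = ≡.cong suc (punchIn-inject₁-fromℕ j)

punchIn-fromℕ : ∀ {n} (k : Fin n) → punchIn (fromℕ n) k ≡ inject₁ k
punchIn-fromℕ zero    = ≡.refl
punchIn-fromℕ (suc k) = ≡.cong suc (punchIn-fromℕ k)

inject₁≢suc : ∀ {n} (p : Fin n) → inject₁ p ≢ suc p
inject₁≢suc (suc p) eq = inject₁≢suc p (suc-injective eq)

module Determinant {a ℓ₁ ℓ₂} (F : HeytingField a ℓ₁ ℓ₂) where

  open HeytingField F using (heytingCommutativeRing)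
  open HeytingCommutativeRing heytingCommutativeRing using (commutativeRing)
  open CommutativeRing commutativeRing hiding (zero)
  open Hankel F using (Matrix; det)
  open import Algebra.Properties.Ring ring using (-1*x≈-x; -‿distribˡ-*)
  open import Algebra.Properties.Semiring.Sum semiring
  open import Algebra.Properties.Semiring.Exp semiring using (_^_)
  open import Relation.Binary.Reasoning.Setoid setoid
  open import Algebra.Solver.Ring.NaturalCoefficients.Default commutativeSemiring
    using (solve; _:=_; _:+_; _:*_)

  -- Finite sums with few nonzero terms.

  sum-zero : ∀ {n} {f : Vector Carrier n} → (∀ i → f i ≈ 0#) → sum f ≈ 0#
  sum-zero {n} f≈0 = trans (sum-cong-≋ f≈0) (sum-replicate-zero n)

  sum-single : ∀ {n} {f : Vector Carrier n} k → (∀ i → i ≢ k → f i ≈ 0#) → sum f ≈ f k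
  sum-single {suc n} {f} k f≈0 = begin
    sum f                                  ≈⟨ sum-remove {i = k} f ⟩
    f k + ∑[ i < n ] f (punchIn k i)       ≈⟨ +-congˡ (sum-zero λ i → f≈0 _ (punchInᵢ≢i k i)) ⟩
    f k + 0#                               ≈⟨ +-identityʳ _ ⟩
    f k                                    ∎

  sum-adjacent : ∀ {n} {f : Vector Carrier (suc n)} p → f (inject₁ p) + f (suc p) ≈ 0# →
    (∀ i → i ≢ inject₁ p → i ≢ suc p → f i ≈ 0#) → sum f ≈ 0#
  sum-adjacent {suc n} {f} zero cancel f≈0 = begin
    f zero + (f (suc zero) + rest)  ≈⟨ +-assoc _ _ _ ⟨
    f zero + f (suc zero) + rest    ≈⟨ +-cong cancel (sum-zero λ i → f≈0 (suc (suc i)) (λ ()) λ ()) ⟩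
    0# + 0#                         ≈⟨ +-identityˡ _ ⟩
    0#                              ∎
    where
    rest : Carrier
    rest = ∑[ i < n ] f (suc (suc i))
  sum-adjacent {suc n} {f} (suc p) cancel f≈0 = begin
    f zero + sum (f ∘ suc)  ≈⟨ +-cong (f≈0 zero (λ ()) λ ())
                                 (sum-adjacent p cancel λ i i≢p i≢1+p →
                                   f≈0 (suc i) (i≢p ∘ suc-injective) (i≢1+p ∘ suc-injective)) ⟩
    0# + 0#                 ≈⟨ +-identityˡ _ ⟩
    0#                      ∎

  -- Minors and linearity of the determinant in a column.

  minor : ∀ {n} → Fin (suc n) → Matrix (suc n) → Matrix n
  minor j A i k = A (suc i) (punchIn j k)

  term : ∀ {n} → Matrix (suc n) → Fin (suc n) → Carrier
  term A j = (- 1#) ^ toℕ j * A zero j * det (minor j A)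

  det-cong : ∀ {n} {A B : Matrix n} → (∀ i j → A i j ≈ B i j) → det A ≈ det B
  det-cong {zero}  A≈B = refl
  det-cong {suc n} {A} {B} A≈B = sum-cong-≋ {x = term A} {y = term B} λ j →
    *-cong (*-congˡ (A≈B zero j)) (det-cong λ i k → A≈B (suc i) (punchIn j k))

  -- Stated for three matrices that agree off column `k`, not for a column replacement, so that the
  -- induction hypothesis applies directly to minors.
  det-linear : ∀ {n} {A B C : Matrix n} k x y →
    (∀ i → C i k ≈ x * A i k + y * B i k) →
    (∀ i j → j ≢ k → C i j ≈ A i j) →
    (∀ i j → j ≢ k → C i j ≈ B i j) →
    det C ≈ x * det A + y * det B
  det-linear {suc n} {A} {B} {C} k x y lin C≈A C≈B = begin
    sum (term C)                                          ≈⟨ sum-cong-≋ term-linear ⟩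
    ∑[ j ≤ n ] (x * term A j + y * term B j)              ≈⟨ ∑-distrib-+ (λ j → x * term A j) (λ j → y * term B j) ⟩
    ∑[ j ≤ n ] (x * term A j) + ∑[ j ≤ n ] (y * term B j)   ≈⟨ +-cong (*-distribˡ-sum x (term A)) (*-distribˡ-sum y (term B)) ⟨
    x * sum (term A) + y * sum (term B)                   ∎
    where
    term-linear : ∀ j → term C j ≈ x * term A j + y * term B j
    term-linear j with j ≟ k
    -- Deleting column `k` makes the three minors agree, so linearity comes from the entry in the
    -- first row.
    ... | yes ≡.refl = begin
      e * C zero j * dC                                ≈⟨ *-congʳ (*-congˡ (lin zero)) ⟩
      e * (x * A zero j + y * B zero j) * dC
        ≈⟨ solve 6 (λ e x a y b d → e :* (x :* a :+ y :* b) :* d := x :* (e :* a :* d) :+ y :* (e :* b :* d)) refl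
             e x (A zero j) y (B zero j) dC ⟩
      x * (e * A zero j * dC) + y * (e * B zero j * dC)
        ≈⟨ +-cong (*-congˡ (*-congˡ (det-cong λ i l → C≈A (suc i) _ (punchInᵢ≢i j l))))
                  (*-congˡ (*-congˡ (det-cong λ i l → C≈B (suc i) _ (punchInᵢ≢i j l)))) ⟩
      x * term A j + y * term B j                      ∎
      where
      e = (- 1#) ^ toℕ j
      dC = det (minor j C)
    -- Here the first-row entries agree and linearity comes from the minors, in which column `k` has
    -- index `punchOut j≢k`.
    ... | no j≢k = begin
      e * C zero j * det (minor j C)                   ≈⟨ *-congˡ minor-linear ⟩
      e * C zero j * (x * dA + y * dB)
        ≈⟨ solve 6 (λ e c x a y b → e :* c :* (x :* a :+ y :* b) := x :* (e :* c :* a) :+ y :* (e :* c :* b)) refl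
             e (C zero j) x dA y dB ⟩
      x * (e * C zero j * dA) + y * (e * C zero j * dB)
        ≈⟨ +-cong (*-congˡ (*-congʳ (*-congˡ (C≈A zero j j≢k))))
                  (*-congˡ (*-congʳ (*-congˡ (C≈B zero j j≢k)))) ⟩
      x * term A j + y * term B j                      ∎
      where
      e = (- 1#) ^ toℕ j
      dA = det (minor j A)
      dB = det (minor j B)
      other : ∀ l → l ≢ punchOut j≢k → punchIn j l ≢ k
      other l l≢k eq =
        l≢k (punchIn-injective j l _ (≡.trans eq (≡.sym (punchIn-punchOut j≢k))))
      minor-linear : det (minor j C) ≈ x * dA + y * dB
      minor-linear = det-linear (punchOut j≢k) x y
        (λ i → ≡.subst (λ l → C (suc i) l ≈ x * A (suc i) l + y * B (suc i) l)
                 (≡.sym (punchIn-punchOut j≢k)) (lin (suc i)))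
        (λ i l l≢k → C≈A (suc i) _ (other l l≢k))
        (λ i l l≢k → C≈B (suc i) _ (other l l≢k))

  det-zero-column : ∀ {n} (A : Matrix n) k → (∀ i → A i k ≈ 0#) → det A ≈ 0#
  det-zero-column A k A≈0 = begin
    det A                     ≈⟨ det-linear {A = A} {A} k 0# 0# (λ i → trans (A≈0 i) (sym 0*x+0*y≈0))
                                   (λ _ _ _ → refl) (λ _ _ _ → refl) ⟩
    0# * det A + 0# * det A   ≈⟨ 0*x+0*y≈0 ⟩
    0#                        ∎
    where
    0*x+0*y≈0 : ∀ {x y} → 0# * x + 0# * y ≈ 0#
    0*x+0*y≈0 = trans (+-cong (zeroˡ _) (zeroˡ _)) (+-identityˡ 0#)

  -- Replacing one column of a matrix.

  infixl 8 _[_]≔_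

  _[_]≔_ : ∀ {n} → Matrix n → Fin n → Vector Carrier n → Matrix n
  (A [ k ]≔ v) i = updateAt (A i) k λ _ → v i

  ≔-updates : ∀ {n} (A : Matrix n) k v i → (A [ k ]≔ v) i k ≈ v i
  ≔-updates A k v i = reflexive (updateAt-updates k (A i))

  ≔-minimal : ∀ {n} (A : Matrix n) {j} k v i → j ≢ k → (A [ k ]≔ v) i j ≈ A i j
  ≔-minimal A {j} k v i j≢k = reflexive (updateAt-minimal j k (A i) j≢k)

  ≔-unique : ∀ {n} (A : Matrix n) {B : Matrix n} k v →
    (∀ i → B i k ≈ v i) → (∀ i j → j ≢ k → B i j ≈ A i j) →
    ∀ i j → (A [ k ]≔ v) i j ≈ B i j
  ≔-unique A k v B≈v B≈A i j with j ≟ k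
  ... | yes ≡.refl = trans (≔-updates A k v i) (sym (B≈v i))
  ... | no  j≢k    = trans (≔-minimal A k v i j≢k) (sym (B≈A i j j≢k))

  ≔-cong : ∀ {n} (A : Matrix n) k {v w} → (∀ i → v i ≈ w i) →
    ∀ i j → (A [ k ]≔ v) i j ≈ (A [ k ]≔ w) i j
  ≔-cong A k {v} {w} v≈w = ≔-unique A k v
    (λ i → trans (≔-updates A k w i) (sym (v≈w i))) (λ i j → ≔-minimal A k w i)

  det-≔-linear : ∀ {n} (A : Matrix n) k x y v w →
    det (A [ k ]≔ λ i → x * v i + y * w i) ≈ x * det (A [ k ]≔ v) + y * det (A [ k ]≔ w)
  det-≔-linear A k x y v w = det-linear k x y
    (λ i → trans (≔-updates A k u i)
             (sym (+-cong (*-congˡ (≔-updates A k v i)) (*-congˡ (≔-updates A k w i)))))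
    (λ i j j≢k → trans (≔-minimal A k u i j≢k) (sym (≔-minimal A k v i j≢k)))
    (λ i j j≢k → trans (≔-minimal A k u i j≢k) (sym (≔-minimal A k w i j≢k)))
    where
    u : Vector Carrier _
    u i = x * v i + y * w i

  det-≔-+ : ∀ {n} (A : Matrix n) k v w →
    det (A [ k ]≔ λ i → v i + w i) ≈ det (A [ k ]≔ v) + det (A [ k ]≔ w)
  det-≔-+ A k v w = begin
    det (A [ k ]≔ λ i → v i + w i)                  ≈⟨ det-cong (≔-cong A k λ i → +-cong (*-identityˡ _) (*-identityˡ _)) ⟨
    det (A [ k ]≔ λ i → 1# * v i + 1# * w i)        ≈⟨ det-≔-linear A k 1# 1# v w ⟩
    1# * det (A [ k ]≔ v) + 1# * det (A [ k ]≔ w)   ≈⟨ +-cong (*-identityˡ _) (*-identityˡ _) ⟩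
    det (A [ k ]≔ v) + det (A [ k ]≔ w)             ∎

  det-≔-∑ : ∀ {n m} (A : Matrix n) k (x : Vector Carrier m) (v : Fin m → Vector Carrier n) →
    det (A [ k ]≔ λ i → ∑[ j < m ] (x j * v j i)) ≈ ∑[ j < m ] (x j * det (A [ k ]≔ v j))
  det-≔-∑ {m = zero}  A k x v =
    det-zero-column (A [ k ]≔ λ _ → 0#) k (≔-updates A k λ _ → 0#)
  det-≔-∑ {m = suc m} A k x v = begin
    det (A [ k ]≔ λ i → x zero * v zero i + w i)               ≈⟨ det-cong (≔-cong A k λ i → +-congˡ (*-identityˡ _)) ⟨
    det (A [ k ]≔ λ i → x zero * v zero i + 1# * w i)          ≈⟨ det-≔-linear A k (x zero) 1# (v zero) w ⟩
    x zero * det (A [ k ]≔ v zero) + 1# * det (A [ k ]≔ w)     ≈⟨ +-congˡ (*-identityˡ _) ⟩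
    x zero * det (A [ k ]≔ v zero) + det (A [ k ]≔ w)          ≈⟨ +-congˡ (det-≔-∑ A k (x ∘ suc) (v ∘ suc)) ⟩
    ∑[ j < suc m ] (x j * det (A [ k ]≔ v j))                  ∎
    where
    w : Vector Carrier _
    w i = ∑[ j < m ] (x (suc j) * v (suc j) i)

  -- Vanishing of determinants with two equal columns.

  punchIn-equal : ∀ {n} (f : Vector Carrier (suc n)) p → f (inject₁ p) ≈ f (suc p) →
    ∀ k → f (punchIn (inject₁ p) k) ≈ f (punchIn (suc p) k)
  punchIn-equal f zero    eq zero    = sym eq
  punchIn-equal f zero    eq (suc k) = refl
  punchIn-equal f (suc p) eq zero    = refl
  punchIn-equal f (suc p) eq (suc k) = punchIn-equal (f ∘ suc) p eq k

  -- In the expansion, the terms of the two equal columns have the same entry and the same minor but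
  -- opposite signs. Every other minor keeps two equal adjacent columns and vanishes by induction.
  det-adjacent : ∀ {n} (A : Matrix (suc n)) p → (∀ i → A i (inject₁ p) ≈ A i (suc p)) → det A ≈ 0#
  det-adjacent {suc n} A p A≈A = sum-adjacent {f = term A} p cancel vanish
    where
    e = (- 1#) ^ toℕ p
    cancel : term A (inject₁ p) + term A (suc p) ≈ 0#
    cancel = begin
      (- 1#) ^ toℕ (inject₁ p) * A zero (inject₁ p) * det (minor (inject₁ p) A) + term A (suc p)
        ≈⟨ +-congʳ (*-cong (*-cong (reflexive (≡.cong ((- 1#) ^_) (toℕ-inject₁ p))) (A≈A zero))
                     (det-cong λ i → punchIn-equal (A (suc i)) p (A≈A (suc i)))) ⟩
      e * x * d + - 1# * e * x * d       ≈⟨ +-congˡ (*-congʳ (*-congʳ (-1*x≈-x e))) ⟩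
      e * x * d + - e * x * d            ≈⟨ +-congˡ (trans (-‿distribˡ-* (e * x) d) (*-congʳ (-‿distribˡ-* e x))) ⟨
      e * x * d - e * x * d              ≈⟨ -‿inverseʳ _ ⟩
      0#                                 ∎
      where
      x = A zero (suc p)
      d = det (minor (suc p) A)
    vanish : ∀ j → j ≢ inject₁ p → j ≢ suc p → term A j ≈ 0#
    vanish j j≢p j≢1+p with q , eq , eq′ ← punchIn-adjacent j p j≢p j≢1+p =
      trans (*-congˡ (det-adjacent (minor j A) q λ i →
              ≡.subst₂ (λ l r → A (suc i) l ≈ A (suc i) r) (≡.sym eq) (≡.sym eq′) (A≈A (suc i))))
            (zeroʳ _)

  -- Polarisation: with `v ⊞ w` in both columns the determinant vanishes, as it does with `v` twice
  -- or `w` twice, so the two mixed terms cancel.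
  det-antisymmetric : ∀ {n} (A : Matrix (suc n)) p v w →
    det (A [ inject₁ p ]≔ v [ suc p ]≔ w) + det (A [ inject₁ p ]≔ w [ suc p ]≔ v) ≈ 0#
  det-antisymmetric A p v w = begin
    D v w + D w v                          ≈⟨ +-cong (+-identityˡ _) (+-identityʳ _) ⟨
    (0# + D v w) + (D w v + 0#)            ≈⟨ +-cong (+-congʳ (D-equal v)) (+-congˡ (D-equal w)) ⟨
    (D v v + D v w) + (D w v + D w w)      ≈⟨ +-cong (det-≔-+ (A [ inject₁ p ]≔ v) (suc p) v w) (det-≔-+ (A [ inject₁ p ]≔ w) (suc p) v w) ⟨
    -- `det-≔-+` acts on the outermost replacement, so the order of the two is exchanged to treat
    -- the other column, and exchanged back afterwards.
    D v (v ⊞ w) + D w (v ⊞ w)              ≈⟨ +-cong (commute v (v ⊞ w)) (commute w (v ⊞ w)) ⟩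
    det (A′ [ inject₁ p ]≔ v) + det (A′ [ inject₁ p ]≔ w)
                                           ≈⟨ det-≔-+ A′ (inject₁ p) v w ⟨
    det (A′ [ inject₁ p ]≔ (v ⊞ w))        ≈⟨ commute (v ⊞ w) (v ⊞ w) ⟨
    D (v ⊞ w) (v ⊞ w)                      ≈⟨ D-equal (v ⊞ w) ⟩
    0#                                     ∎
    where
    D : Vector Carrier _ → Vector Carrier _ → Carrier
    D v w = det (A [ inject₁ p ]≔ v [ suc p ]≔ w)
    _⊞_ : Vector Carrier _ → Vector Carrier _ → Vector Carrier _
    (v ⊞ w) i = v i + w i
    A′ = A [ suc p ]≔ (v ⊞ w)
    D-equal : ∀ v → D v v ≈ 0#
    D-equal v = det-adjacent (A [ inject₁ p ]≔ v [ suc p ]≔ v) p λ i → trans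
      (trans (≔-minimal (A [ inject₁ p ]≔ v) (suc p) v i (inject₁≢suc p)) (≔-updates A (inject₁ p) v i))
      (sym (≔-updates (A [ inject₁ p ]≔ v) (suc p) v i))
    commute : ∀ v w → D v w ≈ det (A [ suc p ]≔ w [ inject₁ p ]≔ v)
    commute v w = det-cong λ i j → reflexive
      (updateAt-commutes (suc p) (inject₁ p) {λ _ → w i} {λ _ → v i} (inject₁≢suc p ∘ ≡.sym) (A i) j)

  -- Induction on the right index `q`: exchanging its column with the left neighbour changes only
  -- the sign and brings the equal columns one step closer, until they are adjacent.
  det-equal-columns-< : ∀ {n} (q : Fin n) (A : Matrix n) p → p Fin.< q →
    (∀ i → A i p ≈ A i q) → det A ≈ 0#
  det-equal-columns-< {suc n} = <-weakInduction P (λ _ _ ()) step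
    where
    P : Fin (suc n) → Set _
    P q = ∀ (A : Matrix (suc n)) p → p Fin.< q → (∀ i → A i p ≈ A i q) → det A ≈ 0#
    step : ∀ q → P (inject₁ q) → P (suc q)
    step q ih A p p<1+q A≈A with p ≟ inject₁ q
    ... | yes ≡.refl = det-adjacent A q A≈A
    ... | no  p≢q    = begin
      det A          ≈⟨ det-cong A≈ ⟨
      det B          ≈⟨ +-identityʳ _ ⟨
      det B + 0#     ≈⟨ +-congˡ (ih C p p<q C≈C) ⟨
      det B + det C  ≈⟨ det-antisymmetric A q v w ⟩
      0#             ∎
      where
      v w : Vector Carrier (suc n)
      v i = A i (inject₁ q)
      w i = A i (suc q)
      B = A [ inject₁ q ]≔ v [ suc q ]≔ w
      C = A [ inject₁ q ]≔ w [ suc q ]≔ v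
      A≈ : ∀ i j → B i j ≈ A i j
      A≈ = ≔-unique _ (suc q) w (λ _ → refl) λ i j _ →
        sym (≔-unique A (inject₁ q) v (λ _ → refl) (λ _ _ _ → refl) i j)
      p<q : p Fin.< inject₁ q
      p<q = ℕ.≤∧≢⇒< (ℕ.≤-trans (ℕ.≤-pred p<1+q) (ℕ.≤-reflexive (≡.sym (toℕ-inject₁ q))))
              (p≢q ∘ toℕ-injective)
      C≈C : ∀ i → C i p ≈ C i (inject₁ q)
      C≈C i = begin
        C i p                            ≈⟨ ≔-minimal (A [ inject₁ q ]≔ w) (suc q) v i (λ where ≡.refl → ℕ.<-irrefl ≡.refl p<1+q) ⟩
        (A [ inject₁ q ]≔ w) i p         ≈⟨ ≔-minimal A (inject₁ q) w i p≢q ⟩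
        A i p                            ≈⟨ A≈A i ⟩
        w i                              ≈⟨ ≔-updates A (inject₁ q) w i ⟨
        (A [ inject₁ q ]≔ w) i (inject₁ q) ≈⟨ ≔-minimal (A [ inject₁ q ]≔ w) (suc q) v i (inject₁≢suc q) ⟨
        C i (inject₁ q)                  ∎

  det-equal-columns : ∀ {n} (A : Matrix n) {p q} → p ≢ q → (∀ i → A i p ≈ A i q) → det A ≈ 0#
  det-equal-columns A {p} {q} p≢q A≈A with <-cmp p q
  ... | tri< p<q _ _ = det-equal-columns-< q A p p<q A≈A
  ... | tri≈ _ p≡q _ = contradiction p≡q p≢q
  ... | tri> _ _ q<p = det-equal-columns-< p A q q<p (sym ∘ A≈A)

  -- Combinations of columns, and columns with a single nonzero entry.

  -- Expanding the new column by linearity, every summand with `j ≢ k` repeats column `j` and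
  -- vanishes.
  cramer : ∀ {n} (A : Matrix n) k (x : Vector Carrier n) →
    det (A [ k ]≔ λ i → ∑[ j < n ] (x j * A i j)) ≈ x k * det A
  cramer A k x = begin
    det (A [ k ]≔ λ i → sum λ j → x j * A i j)      ≈⟨ det-≔-∑ A k x (λ j i → A i j) ⟩
    (sum λ j → x j * det (A [ k ]≔ λ i → A i j))    ≈⟨ sum-single k (λ j j≢k → trans (*-congˡ (repeated j j≢k)) (zeroʳ _)) ⟩
    x k * det (A [ k ]≔ λ i → A i k)                ≈⟨ *-congˡ (det-cong (≔-unique A k (λ i → A i k) (λ _ → refl) λ _ _ _ → refl)) ⟩
    x k * det A                                     ∎
    where
    repeated : ∀ j → j ≢ k → det (A [ k ]≔ λ i → A i j) ≈ 0#
    repeated j j≢k = det-equal-columns (A [ k ]≔ v) j≢k λ i →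
      trans (≔-minimal A k v i j≢k) (sym (≔-updates A k v i))
      where
      v : Vector Carrier _
      v i = A i j

  -- Since `det` expands along the first row, the bottom entry is reached by induction: deleting the
  -- first row and a column other than the last keeps the last column zero above its bottom entry.
  det-last-column-bottom : ∀ {n} (A : Matrix (suc n)) → (∀ i → A (inject₁ i) (fromℕ n) ≈ 0#) →
    det A ≈ A (fromℕ n) (fromℕ n) * det (λ i j → A (inject₁ i) (inject₁ j))
  det-last-column-bottom {zero} A _ =
    trans (+-identityʳ _) (*-congʳ (*-identityˡ _))
  det-last-column-bottom {suc n} A A≈0 = begin
    sum (term A)                                                ≈⟨ sum-init-last (term A) ⟩
    ∑[ j ≤ n ] term A (inject₁ j) + term A (fromℕ (suc n))      ≈⟨ +-cong (sum-cong-≋ expand) last≈0 ⟩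
    ∑[ j ≤ n ] (z * term B j) + 0#                              ≈⟨ +-identityʳ _ ⟩
    ∑[ j ≤ n ] (z * term B j)                                   ≈⟨ *-distribˡ-sum z (term B) ⟨
    z * sum (term B)                                            ∎
    where
    B : Matrix (suc n)
    B i j = A (inject₁ i) (inject₁ j)
    z = A (fromℕ (suc n)) (fromℕ (suc n))
    last≈0 : term A (fromℕ (suc n)) ≈ 0#
    last≈0 = trans (*-congʳ (trans (*-congˡ (A≈0 zero)) (zeroʳ _))) (zeroˡ _)
    last-minor : ∀ j i → minor (inject₁ j) A i (fromℕ n) ≈ A (suc i) (fromℕ (suc n))
    last-minor j i = reflexive (≡.cong (A (suc i)) (punchIn-inject₁-fromℕ j))
    expand : ∀ j → term A (inject₁ j) ≈ z * term B j
    expand j = begin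
      (- 1#) ^ toℕ (inject₁ j) * b * det (minor (inject₁ j) A)
        ≈⟨ *-cong (*-congʳ (reflexive (≡.cong ((- 1#) ^_) (toℕ-inject₁ j))))
             (det-last-column-bottom (minor (inject₁ j) A) λ i → trans (last-minor j (inject₁ i)) (A≈0 (suc i))) ⟩
      e * b * (minor (inject₁ j) A (fromℕ n) (fromℕ n) * det (λ i k → minor (inject₁ j) A (inject₁ i) (inject₁ k)))
        ≈⟨ *-congˡ (*-cong (last-minor j (fromℕ n))
             (det-cong λ i k → reflexive (≡.cong (A (suc (inject₁ i))) (punchIn-inject₁ j k)))) ⟩
      e * b * (z * d)
        ≈⟨ solve 4 (λ e b z d → e :* b :* (z :* d) := z :* (e :* b :* d)) refl e b z d ⟩
      z * (e * b * d)
        ∎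
      where
      e = (- 1#) ^ toℕ j
      b = A zero (inject₁ j)
      d = det (minor j B)

  -- Deleting any column but the last leaves a minor whose last column is zero, so only the last
  -- term of the expansion survives.
  det-last-column-top : ∀ {n} (A : Matrix (suc n)) → (∀ i → A (suc i) (fromℕ n) ≈ 0#) →
    det A ≈ (- 1#) ^ n * A zero (fromℕ n) * det (λ i j → A (suc i) (inject₁ j))
  det-last-column-top {n} A A≈0 = begin
    sum (term A)                                                ≈⟨ sum-init-last (term A) ⟩
    ∑[ j < n ] term A (inject₁ j) + term A (fromℕ n)            ≈⟨ +-cong (sum-zero (vanish A A≈0)) last ⟩
    0# + (- 1#) ^ n * A zero (fromℕ n) * det (λ i j → A (suc i) (inject₁ j))
                                                                ≈⟨ +-identityˡ _ ⟩
    (- 1#) ^ n * A zero (fromℕ n) * det (λ i j → A (suc i) (inject₁ j)) ∎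
    where
    last : term A (fromℕ n) ≈ (- 1#) ^ n * A zero (fromℕ n) * det (λ i j → A (suc i) (inject₁ j))
    last = *-cong (*-congʳ (reflexive (≡.cong ((- 1#) ^_) (toℕ-fromℕ n))))
      (det-cong λ i k → reflexive (≡.cong (A (suc i)) (punchIn-fromℕ k)))
    vanish : ∀ {n} (A : Matrix (suc n)) → (∀ i → A (suc i) (fromℕ n) ≈ 0#) → ∀ j → term A (inject₁ j) ≈ 0#
    vanish {suc n} A A≈0 j = trans (*-congˡ (det-zero-column (minor (inject₁ j) A) (fromℕ n) λ i →
        trans (reflexive (≡.cong (A (suc i)) (punchIn-inject₁-fromℕ j))) (A≈0 i)))
      (zeroʳ _)

module OrthogonalPolynomials {a ℓ₁ ℓ₂} (F : HeytingField a ℓ₁ ℓ₂) where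

  open HeytingField F using (_#_; #⇒invertible; heytingCommutativeRing)
  open HeytingCommutativeRing heytingCommutativeRing using (commutativeRing)
  open CommutativeRing commutativeRing hiding (zero)
  open Hankel F
  open Determinant F
  open import Algebra.Apartness.Properties.HeytingCommutativeRing heytingCommutativeRing
    using (1#0; #-congʳ; x-0≈x; x#0y#0→xy#0)
  open import Algebra.Properties.Ring ring using (-1*x≈-x; -0#≈0#; -‿involutive; -‿distribˡ-*; -‿+-comm)
  open import Algebra.Properties.Semiring.Sum semiring
  open import Algebra.Properties.Semiring.Exp semiring using (_^_)
  open import Algebra.Solver.Ring.NaturalCoefficients.Default commutativeSemiring
    using (solve; _:=_; _:+_; _:*_)
  open import Relation.Binary.Reasoning.Setoid setoid

  -- The functional `L` and the moments of a polynomial.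

  -- Encodes multiplication by a power of `y`: `L (shift m c) p` is the value of `L c` at `y^m p`.
  shift : ℕ → Sequence → Sequence
  shift m c k = c (m ℕ.+ k)

  L-zero : ∀ c p → (∀ k → coeff p k ≈ 0#) → L c p ≈ 0#
  L-zero c []      p≈0 = refl
  L-zero c (x ∷ p) p≈0 = begin
    x * c 0 + L (c ∘ suc) p  ≈⟨ +-cong (trans (*-congʳ (p≈0 0)) (zeroˡ _)) (L-zero (c ∘ suc) p (p≈0 ∘ suc)) ⟩
    0# + 0#                  ≈⟨ +-identityˡ 0# ⟩
    0#                       ∎

  L-cong : ∀ c p q → p ≋ q → L c p ≈ L c q
  L-cong c []      q       p≋q = sym (L-zero c q (sym ∘ p≋q))
  L-cong c (x ∷ p) []      p≋q = L-zero c (x ∷ p) p≋q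
  L-cong c (x ∷ p) (y ∷ q) p≋q =
    +-cong (*-congʳ (p≋q 0)) (L-cong (c ∘ suc) p q (p≋q ∘ suc))

  L-⊕ : ∀ c p q → L c (p ⊕ q) ≈ L c p + L c q
  L-⊕ c []      q       = sym (+-identityˡ _)
  L-⊕ c (x ∷ p) []      = sym (+-identityʳ _)
  L-⊕ c (x ∷ p) (y ∷ q) = begin
    (x + y) * c 0 + L (c ∘ suc) (p ⊕ q)                   ≈⟨ +-congˡ (L-⊕ (c ∘ suc) p q) ⟩
    (x + y) * c 0 + (L (c ∘ suc) p + L (c ∘ suc) q)
      ≈⟨ solve 5 (λ x y c u v → (x :+ y) :* c :+ (u :+ v) := (x :* c :+ u) :+ (y :* c :+ v)) refl
           x y (c 0) (L (c ∘ suc) p) (L (c ∘ suc) q) ⟩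
    (x * c 0 + L (c ∘ suc) p) + (y * c 0 + L (c ∘ suc) q) ∎

  L-∙ : ∀ c x p → L c (x ∙ p) ≈ x * L c p
  L-∙ c x []      = sym (zeroʳ x)
  L-∙ c x (y ∷ p) = begin
    x * y * c 0 + L (c ∘ suc) (x ∙ p)    ≈⟨ +-cong (*-assoc x y (c 0)) (L-∙ (c ∘ suc) x p) ⟩
    x * (y * c 0) + x * L (c ∘ suc) p    ≈⟨ distribˡ x _ _ ⟨
    x * (y * c 0 + L (c ∘ suc) p)        ∎

  L-neg : ∀ c p → L c (map -_ p) ≈ - L c p
  L-neg c []      = sym -0#≈0#
  L-neg c (x ∷ p) = begin
    - x * c 0 + L (c ∘ suc) (map -_ p)   ≈⟨ +-cong (sym (-‿distribˡ-* x (c 0))) (L-neg (c ∘ suc) p) ⟩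
    - (x * c 0) - L (c ∘ suc) p          ≈⟨ -‿+-comm _ _ ⟩
    - (x * c 0 + L (c ∘ suc) p)          ∎

  L-⊖ : ∀ c p q → L c (p ⊖ q) ≈ L c p - L c q
  L-⊖ c p q = trans (L-⊕ c p (map -_ q)) (+-congˡ (L-neg c q))

  -- The values of `L c` at `y^i q` are taken as a new sequence, whose functional is then evaluated
  -- at `p`.
  L-· : ∀ c p q → L c (p · q) ≈ L (λ i → L (shift i c) q) p
  L-· c []      q = refl
  L-· c (x ∷ p) q = begin
    L c (x ∙ q ⊕ (0# ∷ p · q))                          ≈⟨ L-⊕ c (x ∙ q) (0# ∷ p · q) ⟩
    L c (x ∙ q) + (0# * c 0 + L (c ∘ suc) (p · q))      ≈⟨ +-cong (L-∙ c x q) (+-cong (zeroˡ _) (L-· (c ∘ suc) p q)) ⟩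
    x * L c q + (0# + L (λ i → L (shift (suc i) c) q) p) ≈⟨ +-congˡ (+-identityˡ _) ⟩
    x * L c q + L (λ i → L (shift (suc i) c) q) p       ∎

  L-monic : ∀ d n p → MonicOfDegree n p → (∀ i → i ℕ.< n → d i ≈ 0#) → L d p ≈ d n
  -- The empty list is monic only if `0# ≈ 1#`, and then every element is zero.
  L-monic d n       []      (0≈1 , _)   d≈0 = sym (begin
    d n        ≈⟨ *-identityˡ _ ⟨
    1# * d n   ≈⟨ *-congʳ 0≈1 ⟨
    0# * d n   ≈⟨ zeroˡ _ ⟩
    0#         ∎)
  L-monic d zero    (x ∷ p) (x≈1 , p≈0) d≈0 = begin
    x * d 0 + L (d ∘ suc) p   ≈⟨ +-cong (*-congʳ x≈1) (L-zero (d ∘ suc) p λ k → p≈0 (suc k) ℕ.z<s) ⟩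
    1# * d 0 + 0#             ≈⟨ trans (+-identityʳ _) (*-identityˡ _) ⟩
    d 0                       ∎
  L-monic d (suc n) (x ∷ p) (p≈1 , p≈0) d≈0 = begin
    x * d 0 + L (d ∘ suc) p   ≈⟨ +-cong (trans (*-congˡ (d≈0 0 ℕ.z<s)) (zeroʳ x))
                                   (L-monic (d ∘ suc) n p (p≈1 , λ k n<k → p≈0 (suc k) (ℕ.s<s n<k))
                                     λ i i<n → d≈0 (suc i) (ℕ.s<s i<n)) ⟩
    0# + d (suc n)            ≈⟨ +-identityˡ _ ⟩
    d (suc n)                 ∎

  -- The list may be shorter than `n`, or longer with zeros at the end; the combination of columns
  -- in `cramer` needs a sum of fixed length.
  L-bounded : ∀ n c p → (∀ k → n ℕ.≤ k → coeff p k ≈ 0#) →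
    ∑[ j < n ] (coeff p (toℕ j) * c (toℕ j)) ≈ L c p
  L-bounded zero    c p       p≈0 = sym (L-zero c p λ k → p≈0 k ℕ.z≤n)
  L-bounded (suc n) c []      p≈0 = sum-zero {suc n} λ j → zeroˡ (c (toℕ j))
  L-bounded (suc n) c (x ∷ p) p≈0 =
    +-congˡ (L-bounded n (c ∘ suc) p λ k n≤k → p≈0 (suc k) (ℕ.s≤s n≤k))

  -- Hankel determinants with the last column replaced.

  hankel : ∀ n → Sequence → Matrix (suc n)
  hankel n a i j = a (toℕ i ℕ.+ toℕ j)

  shiftedL : ∀ n → Sequence → Poly → Vector Carrier (suc n)
  shiftedL n a p i = L (shift (toℕ i) a) p

  hankelWith : ∀ n → Sequence → Poly → Matrix (suc n)
  hankelWith n a p = hankel n a [ fromℕ n ]≔ shiftedL n a p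

  -- This is `cramer` for the last column with the coefficients of `p` as multipliers; the resulting
  -- factor is the leading coefficient `1#`.
  H-monic : ∀ n a p → MonicOfDegree n p → H n a ≈ det (hankelWith n a p)
  H-monic n a p (p≈1 , p≈0) = begin
    H n a                              ≈⟨ *-identityˡ _ ⟨
    1# * H n a                         ≈⟨ *-congʳ (trans (reflexive (≡.cong (coeff p) (toℕ-fromℕ n))) p≈1) ⟨
    x (fromℕ n) * H n a                ≈⟨ cramer (hankel n a) (fromℕ n) x ⟨
    det (hankel n a [ fromℕ n ]≔ λ i → ∑[ j ≤ n ] (x j * hankel n a i j))
      ≈⟨ det-cong (≔-cong (hankel n a) (fromℕ n) λ i → L-bounded (suc n) (shift (toℕ i) a) p p≈0) ⟩
    det (hankelWith n a p)             ∎
    where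
    x : Fin (suc n) → Carrier
    x j = coeff p (toℕ j)

  hankelWith-last : ∀ n a p i → hankelWith n a p i (fromℕ n) ≈ L (shift (toℕ i) a) p
  hankelWith-last n a p = ≔-updates (hankel n a) (fromℕ n) (shiftedL n a p)

  hankelWith-init : ∀ n a p i j → hankelWith n a p i (inject₁ j) ≈ a (toℕ i ℕ.+ toℕ j)
  hankelWith-init n a p i j = trans
    (≔-minimal (hankel n a) (fromℕ n) (shiftedL n a p) i (fromℕ≢inject₁ ∘ ≡.sym))
    (reflexive (≡.cong (λ k → a (toℕ i ℕ.+ k)) (toℕ-inject₁ j)))

  -- Division and alternating signs.

  */-cancel : ∀ x {y} (y#0 : y # 0#) → x * y / y [ y#0 ] ≈ x
  */-cancel x {y} y#0 with y⁻¹ , _ , y*y⁻¹≈1 ← #⇒invertible y#0 = begin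
    x * y * y⁻¹         ≈⟨ *-assoc x y y⁻¹ ⟩
    -- The inverse supplied by `#⇒invertible` is that of `y - 0#`.
    x * (y * y⁻¹)       ≈⟨ *-congˡ (*-congʳ (x-0≈x y)) ⟨
    x * ((y - 0#) * y⁻¹) ≈⟨ *-congˡ y*y⁻¹≈1 ⟩
    x * 1#              ≈⟨ *-identityʳ x ⟩
    x                   ∎

  -- Multiplying by alternating signs flips only the middle term, since the outer indices differ by
  -- two. The factors `- 1# * e` have the form to which powers of `- 1#` unfold.
  alternating-recurrence : ∀ e {r₀ r₁ r₂ s t x₀ x₁ x₂} →
    r₀ ≈ e * x₀ → r₁ ≈ - 1# * e * x₁ → r₂ ≈ - 1# * (- 1# * e) * x₂ →
    x₂ ≈ s * x₁ - t * x₀ → r₂ ≈ - s * r₁ - t * r₀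
  alternating-recurrence e {r₀} {r₁} {r₂} {s} {t} {x₀} {x₁} {x₂} r₀≈ r₁≈ r₂≈ x₂≈ = begin
    r₂                                                 ≈⟨ r₂≈ ⟩
    - 1# * (- 1# * e) * x₂                             ≈⟨ *-congˡ x₂≈ ⟩
    - 1# * (- 1# * e) * (s * x₁ - t * x₀)              ≈⟨ *-congˡ (+-congˡ (-1*x≈-x _)) ⟨
    - 1# * (- 1# * e) * (s * x₁ + - 1# * (t * x₀))
      -- The solver is for semirings, so `- 1#` enters as a variable `u`; the square of `- 1#` is
      -- evaluated in the next step.
      ≈⟨ solve 6 (λ u e s x t y → u :* (u :* e) :* (s :* x :+ u :* (t :* y))
           := u :* s :* (u :* e :* x) :+ u :* u :* (u :* (t :* (e :* y)))) refl (- 1#) e s x₁ t x₀ ⟩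
    - 1# * s * (- 1# * e * x₁) + - 1# * - 1# * (- 1# * (t * (e * x₀)))
      ≈⟨ +-cong (*-congʳ (-1*x≈-x _))
           (trans (*-cong (trans (-1*x≈-x _) (-‿involutive 1#)) (-1*x≈-x _)) (*-identityˡ _)) ⟩
    - s * (- 1# * e * x₁) - t * (e * x₀)               ≈⟨ +-cong (*-congˡ r₁≈) (-‿cong (*-congˡ r₀≈)) ⟨
    - s * r₁ - t * r₀                                  ∎

  -- Hankel determinants of an orthogonal sequence.

  module _ {c : Sequence} {P : ℕ → Poly} (orthogonal : MonicOrthogonal c P) where

    open MonicOrthogonal orthogonal renaming (orthogonal to L-PP≈0)

    -- By `L-·`, the right side combines the values of `L c` at `y^i P n` with the coefficients of
    -- `P m`; those below `m` vanish by assumption, and `P m` is monic.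
    L-shift-P≈L-PP : ∀ m n → (∀ i → i ℕ.< m → L (shift i c) (P n) ≈ 0#) →
      L (shift m c) (P n) ≈ L c (P m · P n)
    L-shift-P≈L-PP m n low = sym (begin
      L c (P m · P n)                    ≈⟨ L-· c (P m) (P n) ⟩
      L (λ i → L (shift i c) (P n)) (P m) ≈⟨ L-monic _ m (P m) (monic m) low ⟩
      L (shift m c) (P n)                ∎)

    -- Orthogonality to each `P i` becomes orthogonality to each power `y^i`. The induction is on
    -- the bound `m`, so that all lower powers are available when the next one is treated.
    L-shift-P≈0 : ∀ m n → m ℕ.≤ n → ∀ i → i ℕ.< m → L (shift i c) (P n) ≈ 0#
    L-shift-P≈0 (suc m) n m<n i i<1+m with i ℕ.≟ m
    ... | no  i≢m    = L-shift-P≈0 m n (ℕ.<⇒≤ m<n) i (ℕ.≤∧≢⇒< (ℕ.≤-pred i<1+m) i≢m)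
    ... | yes ≡.refl = trans
      (L-shift-P≈L-PP m n (L-shift-P≈0 m n (ℕ.<⇒≤ m<n)))
      (L-PP≈0 m n (ℕ.<⇒≢ m<n))

    L-shift-P≈ζ : ∀ n → L (shift n c) (P n) ≈ ζ n
    L-shift-P≈ζ n = trans (L-shift-P≈L-PP n n (L-shift-P≈0 n n ℕ.≤-refl)) (diagonal n)

    -- The second factor is a determinant of size `n`, not `H (n ∸ 1) c`, so that `n = 0` gives the
    -- empty determinant `1#`.
    H-c : ∀ n → H n c ≈ ζ n * det (λ (i j : Fin n) → c (toℕ i ℕ.+ toℕ j))
    H-c n = begin
      H n c                        ≈⟨ H-monic n c (P n) (monic n) ⟩
      det M                        ≈⟨ det-last-column-bottom M (λ i → trans (hankelWith-last n c (P n) (inject₁ i))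
                                        (L-shift-P≈0 n n ℕ.≤-refl _ (inject₁ℕ< i))) ⟩
      M (fromℕ n) (fromℕ n) * det (λ i j → M (inject₁ i) (inject₁ j))
        ≈⟨ *-cong corner (det-cong λ i j → trans (hankelWith-init n c (P n) (inject₁ i) j)
             (reflexive (≡.cong (λ k → c (k ℕ.+ toℕ j)) (toℕ-inject₁ i)))) ⟩
      ζ n * det (λ (i j : Fin n) → c (toℕ i ℕ.+ toℕ j)) ∎
      where
      M = hankelWith n c (P n)
      corner : M (fromℕ n) (fromℕ n) ≈ ζ n
      corner = begin
        M (fromℕ n) (fromℕ n)              ≈⟨ hankelWith-last n c (P n) (fromℕ n) ⟩
        L (shift (toℕ (fromℕ n)) c) (P n)  ≡⟨ ≡.cong (λ m → L (shift m c) (P n)) (toℕ-fromℕ n) ⟩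
        L (shift n c) (P n)                ≈⟨ L-shift-P≈ζ n ⟩
        ζ n                                ∎

    -- Iterating `H-c` shows that `H n c` is the product of `ζ 0` to `ζ n`, all apart from zero.
    H-c#0 : ∀ n → H n c # 0#
    H-c#0 n = #-congʳ (sym (H-c n)) (x#0y#0→xy#0 (ζ#0 n) (det#0 n))
      where
      det#0 : ∀ n → det (λ (i j : Fin n) → c (toℕ i ℕ.+ toℕ j)) # 0#
      det#0 zero    = 1#0
      det#0 (suc n) = H-c#0 n

    -- By computation `shift (suc i) b` is `shift i c`. Hence orthogonality clears the new column
    -- below its first row, and the minor left over is the Hankel matrix of `c`.
    H-b : ∀ α n → let b = prepend α c in
      H (suc n) b ≈ (- 1#) ^ suc n * L b (P (suc n)) * H n c
    H-b α n = begin
      H (suc n) b   ≈⟨ H-monic (suc n) b (P (suc n)) (monic (suc n)) ⟩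
      det M         ≈⟨ det-last-column-top M (λ i → trans (hankelWith-last (suc n) b (P (suc n)) (suc i))
                         (L-shift-P≈0 (suc n) (suc n) ℕ.≤-refl _ (toℕ<n i))) ⟩
      (- 1#) ^ suc n * M zero (fromℕ (suc n)) * det (λ i j → M (suc i) (inject₁ j))
        ≈⟨ *-cong (*-congˡ (hankelWith-last (suc n) b (P (suc n)) zero))
             (det-cong λ i j → hankelWith-init (suc n) b (P (suc n)) (suc i) j) ⟩
      (- 1#) ^ suc n * L b (P (suc n)) * H n c ∎
      where
      b = prepend α c
      M = hankelWith (suc n) b (P (suc n))

    -- Ratios of Hankel determinants and their recurrence.

    ratio : Carrier → ℕ → Carrier
    ratio α n = H (suc n) (prepend α c) / H n c [ H-c#0 n ]

    H-b/H-c : ∀ α n → let b = prepend α c in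
      ratio α n ≈ (- 1#) ^ suc n * L b (P (suc n))
    H-b/H-c α n = trans (*-congʳ (H-b α n)) (*/-cancel _ (H-c#0 n))

    L-prepend-step : ∀ α {s t} → ThreeTermRecurrence P s t → ∀ n → let b = prepend α c in
      L b (P (suc (suc n))) ≈ s (suc n) * L b (P (suc n)) - t (suc n) * L b (P n)
    L-prepend-step α {s} {t} recurrence n = begin
      L b (P (suc (suc n)))                   ≈⟨ L-cong b (P (suc (suc n))) (q · p ⊖ t (suc n) ∙ P n) (step (suc n) (ℕ.s≤s ℕ.z≤n)) ⟩
      L b (q · p ⊖ t (suc n) ∙ P n)           ≈⟨ L-⊖ b (q · p) (t (suc n) ∙ P n) ⟩
      L b (q · p) - L b (t (suc n) ∙ P n)     ≈⟨ +-cong L-qp (-‿cong (L-∙ b (t (suc n)) (P n))) ⟩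
      s (suc n) * L b p - t (suc n) * L b (P n) ∎
      where
      open ThreeTermRecurrence recurrence
      b = prepend α c
      p = P (suc n)
      q = Y ⊕ const (s (suc n))
      L-qp : L b (q · p) ≈ s (suc n) * L b p
      L-qp = begin
        L b (q · p)                                          ≈⟨ L-· b q p ⟩
        -- Multiplication by `y` shifts `b` to `c`, so the term `Y` contributes `L c p`, which
        -- vanishes because `p` is orthogonal to the constants.
        (0# + s (suc n)) * L b p + (1# * L c p + 0#)
          ≈⟨ +-cong (*-congʳ (+-identityˡ _)) (trans (+-identityʳ _) (*-identityˡ _)) ⟩
        s (suc n) * L b p + L c p                            ≈⟨ +-congˡ (L-shift-P≈0 (suc n) (suc n) ℕ.≤-refl 0 ℕ.z<s) ⟩
        s (suc n) * L b p + 0#                               ≈⟨ +-identityʳ _ ⟩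
        s (suc n) * L b p                                    ∎

    -- Three index variables, since comparing H at n ∸ 1 with H at a pattern for its
    -- value would make the type checker expand both determinants.
    ratio-recurrence : ∀ α {s t} → ThreeTermRecurrence P s t →
      ∀ {n n-1 n-2} → n ≡ suc n-1 → n-1 ≡ suc n-2 →
      let b = prepend α c in
      H (suc n) b / H n c [ H-c#0 n ]
        ≈ - s n * (H n b / H n-1 c [ H-c#0 n-1 ]) - t n * (H n-1 b / H n-2 c [ H-c#0 n-2 ])
    ratio-recurrence α recurrence {n-2 = n} ≡.refl ≡.refl = alternating-recurrence ((- 1#) ^ suc n)
      (H-b/H-c α n) (H-b/H-c α (suc n)) (H-b/H-c α (suc (suc n)))
      (L-prepend-step α recurrence (suc n))

lemma2p5 : ∀ {a ℓ₁ ℓ₂} (F : HeytingField a ℓ₁ ℓ₂) →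
  let open HeytingField F
      open Hankel F
  in
  (c : Sequence) (P : ℕ → Poly) → MonicOrthogonal c P →
  (s t : Sequence) → ThreeTermRecurrence P s t →
  (α : Carrier) →
  let b = prepend α c in
  Σ[ H#0 ∈ (∀ n → H n c # 0#) ]
    (∀ n → 2 ℕ.≤ n →
      H (suc n) b / H n c [ H#0 n ]
        ≈ - s n * (H n b / H (n ℕ.∸ 1) c [ H#0 (n ℕ.∸ 1) ])
          - t n * (H (n ℕ.∸ 1) b / H (n ℕ.∸ 2) c [ H#0 (n ℕ.∸ 2) ]))
lemma2p5 F c P orthogonal s t recurrence α = H-c#0 orthogonal , λ n 2≤n →
  ratio-recurrence orthogonal α recurrence {n} {n ℕ.∸ 1} {n ℕ.∸ 2}
    -- `(1 + n) ∸ 1` computes to `n` and `(1 + n) ∸ 2` to `n ∸ 1`, so these are `n ≡ suc (n ∸ 1)`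
    -- and `n ∸ 1 ≡ suc (n ∸ 2)`.
    (ℕ.+-∸-assoc 1 {n} {1} (ℕ.<⇒≤ 2≤n)) (ℕ.+-∸-assoc 1 {n} {2} 2≤n)
  where open OrthogonalPolynomials F
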